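{- If $G$ is a finite simple graph with independence number $\alpha(G) \le 2$, then $\chi(G) \le \Delta_2(G) + 2$. Equivalently, if $H$ is a finite triangle-free graph, then $\overline{\chi}(H) \le \overline{\Delta_2}(H) + 2$.
   Context: For distinct vertices $u,v$, $\operatorname{codeg}(u,v)$ is the number of common neighbors, and $\Delta_2(G)=\max_{u\ne v}\operatorname{codeg}(u,v)$. The anti-codegree of vertices $v,w$ of $H$ is $\overline{\operatorname{codeg}}(v,w) = |V(H)\setminus(N(v)\cup N(w)\cup\{v,w\})|$, and $\overline{\Delta_2}(H)=\max_{v,w}\overline{\operatorname{codeg}}(v,w)$ (which equals $\Delta_2$ of the complement of $H$). $\overline{\chi}(H)$ is the clique cover number of $H$, i.e. the minimum number of cliques needed to cover $V(H)$. -}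

module Defs where

open import Data.Nat using (ℕ; zero; suc; _+_; _⊔_; _≤_)
open import Data.Fin using (Fin)
open import Data.List using (List; []; _∷_; filter; length; foldr; map; concatMap; allFin)
open import Data.Product using (_×_; _,_; Σ; ∃-syntax)
open import Data.Sum using (_⊎_)
open import Relation.Nullary using (¬_; Dec)
open import Relation.Unary using (Decidable)
open import Relation.Binary.PropositionalEquality using (_≡_; _≢_)
open import Data.Fin using (_≟_)
open import Relation.Nullary.Decidable using (⌊_⌋; ¬?; _×-dec_)

record Graph (n : ℕ) : Set₁ where
  field
    Adj      : Fin n → Fin n → Set
    adj?     : (u v : Fin n) → Dec (Adj u v)
    sym      : ∀ {u v} → Adj u v → Adj v u
    irrefl   : ∀ {u} → ¬ Adj u u

open Graph public

codeg : ∀ {n} → Graph n → Fin n → Fin n → ℕ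
codeg G u v = length (filter (λ w → adj? G u w ×-dec adj? G v w) (allFin _))

-- Δ₂(G) = max over distinct u ≠ v of codeg(u,v)  (0 if there are fewer than two vertices).
Δ₂ : ∀ {n} → Graph n → ℕ
Δ₂ {n} G =
  foldr _⊔_ 0
    (concatMap (λ u →
       map (λ v → codeg G u v)
           (filter (λ v → ¬? (u ≟ v)) (allFin n)))
     (allFin n))

IndependenceNumber≤2 : ∀ {n} → Graph n → Set
IndependenceNumber≤2 {n} G =
  (x y z : Fin n) → x ≢ y → y ≢ z → x ≢ z →
  Adj G x y ⊎ Adj G y z ⊎ Adj G x z

ProperColouring : ∀ {n} → Graph n → ℕ → Set
ProperColouring {n} G k =
  Σ (Fin n → Fin k) λ c → ∀ u v → Adj G u v → c u ≢ c v

χ≤ : ∀ {n} → Graph n → ℕ → Set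
χ≤ G k = ProperColouring G k

{-# OPTIONS --safe #-}
-- Start from the colouring with n colours and remove colours one at a time while their number k
-- exceeds Δ₂ + 2.  If two colour classes {v} and {w} are singletons, then, as k - 2 > codeg(v,w), some
-- other class avoids the common neighbourhood of v and w; by α ≤ 2 it can be divided among the
-- classes of v and w.  If at most one class is a singleton, then n ≥ 2k - 1 ≥ 2Δ₂ + 5, which is
-- impossible: whenever n > 2Δ₂ + 4, any two pairs {p,q} and {r,s} leave a fifth vertex that is a
-- common neighbour of neither, and in the triangle-free complement such vertices successively give
-- an edge, a path with two edges and a 4-cycle; the two diagonals of a 4-cycle leave no such vertex.
module Submission where

open import Defs
open import Data.Empty using (⊥; ⊥-elim)
open import Data.Fin using (Fin; zero; _≟_; _↑ˡ_; punchIn; punchOut; splitAt; join)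
open import Data.Fin.Properties using (injective⇒≤; ¬∀⟶∃¬; any?; all?; punchOut-injective; punchIn-injective; punchInᵢ≢i; ↑ˡ-injective; join-splitAt)
open import Data.List using (List; []; _∷_; _++_; allFin; filter; foldr; length; map)
open import Data.List.Membership.Propositional using (_∈_; _∉_)
open import Data.List.Membership.Propositional.Properties using (∈-++⁺ˡ; ∈-++⁺ʳ; ∈-allFin; ∈-concatMap⁺; ∈-filter⁺; ∈-map⁺)
open import Data.List.Membership.Setoid.Properties using (index-injective)
open import Data.List.Properties using (length-++; length-map)
open import Data.List.Relation.Unary.Any as Any using (here; there; index)
open import Data.Nat using (ℕ; zero; suc; _+_; _≤_; _<_; _⊔_; s≤s; z≤n)
open import Data.Nat.Properties using (+-comm; +-mono-≤; +-monoʳ-≤; <-irrefl; m≤m⊔n; m≤n+m; m≤n⊔m; ≤-<-trans; ≤-refl; ≤-trans; ≮⇒≥; <-≤-trans; module ≤-Reasoning)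
open import Data.Nat.Solver using (module +-*-Solver)
open import Data.Product using (_×_; _,_; ∃-syntax; proj₁; proj₂)
open import Data.Sum using (_⊎_; inj₁; inj₂; [_,_]′)
open import Function using (_∘_)
open import Relation.Binary.PropositionalEquality using (_≡_; _≢_; refl; trans; cong; subst; setoid; ≢-sym) renaming (sym to ≡-sym)
open import Relation.Nullary using (¬_; Dec; yes; no)
open import Relation.Nullary.Decidable using (¬?; _×-dec_; decidable-stable)

import Data.List.Membership.DecPropositional as DecMembership

-- Pigeonhole on lists of vertices, and codegrees bounded by `Δ₂`.

covering⇒≤ : ∀ {n} (xs : List (Fin n)) → (∀ x → x ∈ xs) → n ≤ length xs
covering⇒≤ xs cover = injective⇒≤ {f = λ x → index (cover x)} λ {x} {y} →
  index-injective (setoid _) (cover x) (cover y)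

short⇒∃∉ : ∀ {n} (xs : List (Fin n)) → length xs < n → ∃[ x ] x ∉ xs
short⇒∃∉ {n} xs short = ¬∀⟶∃¬ n (_∈ xs) (_∈? xs) λ cover →
  <-irrefl refl (<-≤-trans short (covering⇒≤ xs cover))
  where open DecMembership _≟_ using (_∈?_)

∈⇒≤foldr-⊔ : ∀ {m} {ms : List ℕ} → m ∈ ms → m ≤ foldr _⊔_ 0 ms
∈⇒≤foldr-⊔ {ms = m ∷ ms} (here refl)  = m≤m⊔n m (foldr _⊔_ 0 ms)
∈⇒≤foldr-⊔ {ms = m ∷ ms} (there m∈ms) = ≤-trans (∈⇒≤foldr-⊔ m∈ms) (m≤n⊔m m (foldr _⊔_ 0 ms))

codeg≤Δ₂ : ∀ {n} (G : Graph n) {u v} → u ≢ v → codeg G u v ≤ Δ₂ G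
codeg≤Δ₂ {n} G {u} {v} u≢v = ∈⇒≤foldr-⊔
  (∈-concatMap⁺ row (Any.map (λ where refl → codeg∈row) (∈-allFin u)))
  where
  row : Fin n → List ℕ
  row u = map (codeg G u) (filter (λ v → ¬? (u ≟ v)) (allFin n))

  codeg∈row : codeg G u v ∈ row u
  codeg∈row = ∈-map⁺ (codeg G u) (∈-filter⁺ (λ v → ¬? (u ≟ v)) (∈-allFin v) u≢v)

removeUnusedColour : ∀ {n k} (G : Graph n) ((c , _) : ProperColouring G (suc k)) (i : Fin (suc k)) →
  (∀ x → c x ≢ i) → χ≤ G k
removeUnusedColour G (c , proper) i unused =
  (λ x → punchOut (≢-sym (unused x))) ,
  λ u v u~v eq → proper u v u~v (punchOut-injective (≢-sym (unused u)) (≢-sym (unused v)) eq)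

-- Common neighbours and non-adjacency.

module _ {n : ℕ} (G : Graph n) where

  CommonNeighbour : Fin n → Fin n → Fin n → Set
  CommonNeighbour u v x = Adj G u x × Adj G v x

  commonNeighbour? : ∀ u v x → Dec (CommonNeighbour u v x)
  commonNeighbour? u v x = adj? G u x ×-dec adj? G v x

  commonNeighbours : Fin n → Fin n → List (Fin n)
  commonNeighbours u v = filter (commonNeighbour? u v) (allFin n)

  ∈-commonNeighbours : ∀ {u v x} → CommonNeighbour u v x → x ∈ commonNeighbours u v
  ∈-commonNeighbours {u} {v} {x} = ∈-filter⁺ (commonNeighbour? u v) (∈-allFin x)

  infix 4 _≁_

  -- Adjacency in the complement of `G`.
  _≁_ : Fin n → Fin n → Set
  x ≁ y = x ≢ y × ¬ Adj G x y

  ≁-sym : ∀ {x y} → x ≁ y → y ≁ x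
  ≁-sym (x≢y , ¬x~y) = ≢-sym x≢y , ¬x~y ∘ sym G

  ¬commonNeighbour⇒≁ : ∀ {u v x} → x ≢ u → x ≢ v → ¬ CommonNeighbour u v x → x ≁ u ⊎ x ≁ v
  ¬commonNeighbour⇒≁ {u} {v} {x} x≢u x≢v ¬common with adj? G u x
  ... | no ¬u~x = inj₁ (x≢u , ¬u~x ∘ sym G)
  ... | yes u~x = inj₂ (x≢v , λ x~v → ¬common (u~x , sym G x~v))

  module _ (α≤2 : IndependenceNumber≤2 G) where

    ≁-triangleFree : ∀ {x y z} → x ≁ y → y ≁ z → ¬ x ≁ z
    ≁-triangleFree (x≢y , ¬x~y) (y≢z , ¬y~z) (x≢z , ¬x~z) =
      [ ¬x~y , [ ¬y~z , ¬x~z ]′ ]′ (α≤2 _ _ _ x≢y y≢z x≢z)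

    -- A bound on the number of vertices.

    module _ {d : ℕ} (codeg≤d : ∀ {u v} → u ≢ v → codeg G u v ≤ d) where

      Escape : Fin n → Fin n → Fin n → Fin n → Set
      Escape p q r s = ∃[ x ] (x ≢ p × x ≢ q × x ≢ r × x ≢ s) × (x ≁ p ⊎ x ≁ q) × (x ≁ r ⊎ x ≁ s)

      -- The two pairs together with their common neighbours fill at most 4 + 2d places. The pairs
      -- may overlap or coincide, as they do in `noPath` and `noEdge`.
      escape : 4 + (d + d) < n → ∀ {p q r s} → p ≢ q → r ≢ s → Escape p q r s
      escape large {p} {q} {r} {s} p≢q r≢s with short⇒∃∉ covered (≤-<-trans length-covered large)
        where
        covered : List (Fin n)
        covered = p ∷ q ∷ r ∷ s ∷ commonNeighbours p q ++ commonNeighbours r s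

        length-covered : length covered ≤ 4 + (d + d)
        length-covered = +-monoʳ-≤ 4 (subst (_≤ d + d)
          (≡-sym (length-++ (commonNeighbours p q)))
          (+-mono-≤ (codeg≤d p≢q) (codeg≤d r≢s)))
      ... | x , x∉ =
        x , (x≢p , x≢q , x≢r , x≢s) ,
        ¬commonNeighbour⇒≁ x≢p x≢q
          (λ common → x∉′ (∈-++⁺ˡ (∈-commonNeighbours common))) ,
        ¬commonNeighbour⇒≁ x≢r x≢s
          (λ common → x∉′ (∈-++⁺ʳ (commonNeighbours p q) (∈-commonNeighbours common)))
        where
        x≢p : x ≢ p
        x≢p = x∉ ∘ here
        x≢q : x ≢ q
        x≢q = x∉ ∘ there ∘ here
        x≢r : x ≢ r
        x≢r = x∉ ∘ there ∘ there ∘ here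
        x≢s : x ≢ s
        x≢s = x∉ ∘ there ∘ there ∘ there ∘ here
        x∉′ : x ∉ commonNeighbours p q ++ commonNeighbours r s
        x∉′ = x∉ ∘ there ∘ there ∘ there ∘ there

      module _ (large : 4 + (d + d) < n) where

        -- For the diagonals {a,b} and {u,v}, the escaping x is joined to one end of each. Those
        -- ends are consecutive on the cycle, so a triangle of `≁` closes.
        no4Cycle : ∀ {a b u v} → a ≢ b → u ≢ v → u ≁ a → u ≁ b → v ≁ a → v ≁ b → ⊥
        no4Cycle a≢b u≢v ua ub va vb with escape large a≢b u≢v
        ... | x , _ , inj₁ xa , inj₁ xu = ≁-triangleFree xu ua xa
        ... | x , _ , inj₁ xa , inj₂ xv = ≁-triangleFree xv va xa
        ... | x , _ , inj₂ xb , inj₁ xu = ≁-triangleFree xu ub xb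
        ... | x , _ , inj₂ xb , inj₂ xv = ≁-triangleFree xv vb xb

        -- Escape from {a,b} and {c,v}: `x ≁ v` closes a triangle, while `x ≁ c` closes a 4-cycle
        -- through v, c, x and one of a, b.
        noClaw : ∀ {v a b c} → a ≢ b → c ≢ a → c ≢ b → v ≁ a → v ≁ b → v ≁ c → ⊥
        noClaw a≢b c≢a c≢b va vb vc with escape large a≢b (≢-sym (proj₁ vc))
        ... | x , _ , inj₁ xa , inj₂ xv = ≁-triangleFree xv va xa
        ... | x , _ , inj₂ xb , inj₂ xv = ≁-triangleFree xv vb xb
        ... | x , (_ , _ , _ , x≢v) , inj₁ xa , inj₁ xc = no4Cycle (≢-sym c≢a) (≢-sym x≢v) va vc xa xc
        ... | x , (_ , _ , _ , x≢v) , inj₂ xb , inj₁ xc = no4Cycle (≢-sym c≢b) (≢-sym x≢v) vb vc xb xc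

        -- Escape from {v,a} and {v,b}: x is either a third leaf at v, or the fourth vertex of a
        -- cycle v, a, x, b.
        noPath : ∀ {v a b} → a ≢ b → v ≁ a → v ≁ b → ⊥
        noPath a≢b va vb with escape large (proj₁ va) (proj₁ vb)
        ... | x , (_ , x≢a , _ , x≢b) , inj₁ xv , _       = noClaw a≢b x≢a x≢b va vb (≁-sym xv)
        ... | x , (_ , x≢a , _ , x≢b) , inj₂ xa , inj₁ xv = noClaw a≢b x≢a x≢b va vb (≁-sym xv)
        ... | x , (x≢v , _)           , inj₂ xa , inj₂ xb = no4Cycle a≢b (≢-sym x≢v) va vb xa xb

        noEdge : ∀ {u v} → ¬ u ≁ v
        noEdge uv with escape large (proj₁ uv) (proj₁ uv)
        ... | x , (_ , x≢v , _) , inj₁ xu , _ = noPath (≢-sym x≢v) uv (≁-sym xu)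
        ... | x , (x≢u , _)     , inj₂ xv , _ = noPath (≢-sym x≢u) (≁-sym uv) (≁-sym xv)

        notLarge : ⊥
        notLarge with short⇒∃∉ [] (≤-<-trans z≤n large)
        ... | u , _ with short⇒∃∉ (u ∷ []) (≤-<-trans (s≤s z≤n) large)
        ... | v , v∉ with escape large (v∉ ∘ here) (v∉ ∘ here)
        ... | x , _ , inj₁ xv , _ = noEdge xv
        ... | x , _ , inj₂ xu , _ = noEdge xu

      n≤4+2d : n ≤ 4 + (d + d)
      n≤4+2d = ≮⇒≥ notLarge

    -- Dissolving a colour class into two singleton classes.

    module _ {k : ℕ} (c : Fin n → Fin (suc k)) (proper : ∀ u v → Adj G u v → c u ≢ c v) where

      -- Only the inclusion of class i in {v}; that v has colour i is supplied separately.
      IsClass : Fin (suc k) → Fin n → Set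
      IsClass i v = ∀ z → c z ≡ i → z ≡ v

      -- The class of x is dissolved: x joins {v}, and the other members join {w}.  The latter are
      -- not adjacent to w, since otherwise they would not be adjacent to v and form with x and v
      -- an independent set.
      mergeInto : ∀ {i j v w} → IsClass i v → IsClass j w → i ≢ j →
        ∀ {x} → c x ≢ i → c x ≢ j → (∀ y → c y ≡ c x → ¬ CommonNeighbour v w y) →
        c v ≡ i → x ≁ v → χ≤ G k
      mergeInto {i} {j} {v} {w} i-v j-w i≢j {x} l≢i l≢j noCommon cv≡i xv =
        removeUnusedColour G (c′ , proper′) (c x) unused
        where
        -- The reason why z receives its new colour. With the new colour as index, two vertices can
        -- be compared by their reasons alone.
        data View (z : Fin n) : Fin (suc k) → Set where
          kept  : c z ≢ c x → View z (c z)
          moved : z ≡ x → View z i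
          rest  : c z ≡ c x → z ≢ x → View z j

        recolour : ∀ z → ∃[ m ] View z m
        recolour z with c z ≟ c x | z ≟ x
        ... | no  cz≢l | _       = c z , kept cz≢l
        ... | yes _    | yes z≡x = i , moved z≡x
        ... | yes cz≡l | no z≢x  = j , rest cz≡l z≢x

        c′ : Fin n → Fin (suc k)
        c′ z = proj₁ (recolour z)

        rest-¬~w : ∀ {z} → c z ≡ c x → z ≢ x → ¬ Adj G w z
        rest-¬~w {z} cz≡l z≢x w~z = ≁-triangleFree zx xv zv
          where
          zx : z ≁ x
          zx = z≢x , λ z~x → proper z x z~x cz≡l
          zv : z ≁ v
          zv = (λ z≡v → l≢i (trans (≡-sym cz≡l) (trans (cong c z≡v) cv≡i))) ,
               λ z~v → noCommon z cz≡l (sym G z~v , w~z)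

        conflictFree : ∀ {y z m m′} → View y m → View z m′ → m ≡ m′ → ¬ Adj G y z
        conflictFree (kept _) (kept _) eq y~z = proper _ _ y~z eq
        -- A kept vertex of colour i is v and one of colour j is w, so only edges from v to x and
        -- from w to the rest must be excluded.
        conflictFree {y} (kept _) (moved refl) eq y~z =
          proj₂ (≁-sym xv) (subst (λ u → Adj G u x) (i-v y eq) y~z)
        conflictFree {y} {z} (kept _) (rest cz≡l z≢x) eq y~z =
          rest-¬~w cz≡l z≢x (subst (λ u → Adj G u z) (j-w y eq) y~z)
        conflictFree {z = z} (moved refl) (kept _) eq y~z =
          proj₂ xv (subst (Adj G x) (i-v z (≡-sym eq)) y~z)
        conflictFree {y} {z} (rest cy≡l y≢x) (kept _) eq y~z =
          rest-¬~w cy≡l y≢x (subst (λ u → Adj G u y) (j-w z (≡-sym eq)) (sym G y~z))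
        conflictFree (moved refl) (moved refl) _ y~z = irrefl G y~z
        conflictFree (moved _) (rest _ _) eq _ = i≢j eq
        conflictFree (rest _ _) (moved _) eq _ = i≢j (≡-sym eq)
        conflictFree (rest cy≡l _) (rest cz≡l _) _ y~z = proper _ _ y~z (trans cy≡l (≡-sym cz≡l))

        proper′ : ∀ y z → Adj G y z → c′ y ≢ c′ z
        proper′ y z y~z eq = conflictFree (proj₂ (recolour y)) (proj₂ (recolour z)) eq y~z

        view≢ : ∀ {z m} → View z m → m ≢ c x
        view≢ (kept cz≢l) = cz≢l
        view≢ (moved _)   = ≢-sym l≢i
        view≢ (rest _ _)  = ≢-sym l≢j

        unused : ∀ z → c′ z ≢ c x
        unused z = view≢ (proj₂ (recolour z))

      -- The colours of v, w and their common neighbours number at most codeg + 2, fewer than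
      -- `suc k`, so some class avoids them all. A member x of it is non-adjacent to v or to w,
      -- which decides the roles in `mergeInto`.
      mergeSingletons : ∀ {v w} → IsClass (c v) v → IsClass (c w) w → c v ≢ c w →
        suc (codeg G v w) < k → (∀ l → ∃[ x ] c x ≡ l) → χ≤ G k
      mergeSingletons {v} {w} v-class w-class cv≢cw codeg<k used
        with short⇒∃∉ (c v ∷ c w ∷ map c (commonNeighbours v w))
               (s≤s (subst (λ m → suc m < k) (≡-sym (length-map c (commonNeighbours v w))) codeg<k))
      ... | l , l∉ with used l
      ... | x , refl =
        [ mergeInto v-class w-class cv≢cw (l∉ ∘ here) (l∉ ∘ there ∘ here) noCommon refl
        , mergeInto w-class v-class (≢-sym cv≢cw) (l∉ ∘ there ∘ here) (l∉ ∘ here)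
            (λ y eq (w~y , v~y) → noCommon y eq (v~y , w~y)) refl
        ]′ (¬commonNeighbour⇒≁ (l∉ ∘ here ∘ cong c) (l∉ ∘ there ∘ here ∘ cong c) (noCommon x refl))
        where
        noCommon : ∀ y → c y ≡ c x → ¬ CommonNeighbour v w y
        noCommon y cy≡l common = l∉ (there (there
          (subst (_∈ map c (commonNeighbours v w)) cy≡l (∈-map⁺ c (∈-commonNeighbours common)))))

      -- Counting vertices by the sizes of the classes.

      module _ (rep : Fin (suc k) → Fin n) (c-rep : ∀ i → c (rep i) ≡ i) where

        Doubled : Fin (suc k) → Set
        Doubled i = ∃[ z ] (c z ≡ i × z ≢ rep i)

        doubled? : ∀ i → Dec (Doubled i)
        doubled? i = any? λ z → (c z ≟ i) ×-dec ¬? (z ≟ rep i)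

        ¬doubled⇒class : ∀ {i} → ¬ Doubled i → IsClass (c (rep i)) (rep i)
        ¬doubled⇒class {i} ¬d z eq =
          decidable-stable (z ≟ rep i) λ z≢ → ¬d (z , trans eq (c-rep i) , z≢)

        -- Each class gives its representative, and each class except i also a second member;
        -- `punchIn i` enumerates these k classes.
        allButOneDoubled⇒≤ : ∀ i → (∀ j → j ≢ i → Doubled j) → suc k + k ≤ n
        allButOneDoubled⇒≤ i doubled = injective⇒≤ {f = pick ∘ splitAt (suc k)} λ {x} {y} eq →
          splitAt-injective x y (pick-injective _ _ eq)
          where
          twin : ∀ j → Doubled (punchIn i j)
          twin j = doubled (punchIn i j) (punchInᵢ≢i i j)

          pick : Fin (suc k) ⊎ Fin k → Fin n
          pick = [ rep , proj₁ ∘ twin ]′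

          rep≢twin : ∀ a b → rep a ≢ proj₁ (twin b)
          rep≢twin a b eq with twin b
          ... | z , cz , z≢ = z≢ (trans (≡-sym eq)
            (cong rep (trans (≡-sym (c-rep a)) (trans (cong c eq) cz))))

          pick-injective : ∀ p q → pick p ≡ pick q → p ≡ q
          pick-injective (inj₁ a) (inj₁ b) eq =
            cong inj₁ (trans (≡-sym (c-rep a)) (trans (cong c eq) (c-rep b)))
          pick-injective (inj₁ a) (inj₂ b) eq = ⊥-elim (rep≢twin a b eq)
          pick-injective (inj₂ a) (inj₁ b) eq = ⊥-elim (rep≢twin b a (≡-sym eq))
          pick-injective (inj₂ a) (inj₂ b) eq = cong inj₂ (punchIn-injective i a b
            (trans (≡-sym (proj₁ (proj₂ (twin a)))) (trans (cong c eq) (proj₁ (proj₂ (twin b))))))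

          splitAt-injective : ∀ x y → splitAt (suc k) x ≡ splitAt (suc k) y → x ≡ y
          splitAt-injective x y eq = trans (≡-sym (join-splitAt (suc k) k x))
            (trans (cong (join (suc k) k) eq) (join-splitAt (suc k) k y))

        findSingletons :
          (∃[ i ] ∃[ j ] (i ≢ j × ¬ Doubled i × ¬ Doubled j)) ⊎ (∃[ i ] (∀ j → j ≢ i → Doubled j))
        findSingletons with any? (¬? ∘ doubled?)
        -- Without singleton classes any colour can serve as the exception.
        ... | no none = inj₂ (zero , λ j _ → decidable-stable (doubled? j) λ ¬d → none (j , ¬d))
        ... | yes (i , ¬di) with any? (λ j → ¬? (i ≟ j) ×-dec ¬? (doubled? j))
        ... | yes (j , i≢j , ¬dj) = inj₁ (i , j , i≢j , ¬di , ¬dj)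
        ... | no none = inj₂ (i , λ j j≢i →
          decidable-stable (doubled? j) λ ¬d → none (j , ≢-sym j≢i , ¬d))

    -- Descent on the number of colours.

    removeColour : ∀ {k} → Δ₂ G + 2 ≤ k → χ≤ G (suc k) → χ≤ G k
    removeColour {k} Δ₂+2≤k colouring@(c , proper) with all? (λ i → any? λ x → c x ≟ i)
    ... | no ¬used with ¬∀⟶∃¬ _ _ (λ i → any? λ x → c x ≟ i) ¬used
    ...   | i , unused = removeUnusedColour G colouring i λ x cx≡i → unused (x , cx≡i)
    removeColour {k} Δ₂+2≤k colouring@(c , proper) | yes used
      with findSingletons c proper (proj₁ ∘ used) (proj₂ ∘ used)
    ... | inj₁ (i , j , i≢j , ¬di , ¬dj) =
      mergeSingletons c proper (class ¬di) (class ¬dj) ci≢cj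
        (≤-trans (s≤s (s≤s (codeg≤Δ₂ G (ci≢cj ∘ cong c)))) (subst (_≤ k) (+-comm (Δ₂ G) 2) Δ₂+2≤k))
        used
      where
      class = ¬doubled⇒class c proper (proj₁ ∘ used) (proj₂ ∘ used)

      ci≢cj : c (proj₁ (used i)) ≢ c (proj₁ (used j))
      ci≢cj eq = i≢j (trans (≡-sym (proj₂ (used i))) (trans eq (proj₂ (used j))))
    -- Here k counts the colours after the removal, so the classes give 2k + 1 vertices, against n ≤
    -- 2Δ₂ + 4 ≤ 2k.
    ... | inj₂ (i , doubled) = ⊥-elim (<-irrefl refl (begin-strict
      4 + (Δ₂ G + Δ₂ G)           ≡⟨ solve 1 (λ d → con 4 :+ (d :+ d) := (d :+ con 2) :+ (d :+ con 2)) refl (Δ₂ G) ⟩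
      (Δ₂ G + 2) + (Δ₂ G + 2)     ≤⟨ +-mono-≤ Δ₂+2≤k Δ₂+2≤k ⟩
      k + k                       <⟨ ≤-refl ⟩
      suc k + k                   ≤⟨ allButOneDoubled⇒≤ c proper (proj₁ ∘ used) (proj₂ ∘ used) i doubled ⟩
      n                           ≤⟨ n≤4+2d (codeg≤Δ₂ G) ⟩
      4 + (Δ₂ G + Δ₂ G)           ∎))
      where
      open ≤-Reasoning
      open +-*-Solver

    removeColours : ∀ j → χ≤ G (j + (Δ₂ G + 2)) → χ≤ G (Δ₂ G + 2)
    removeColours zero    colouring = colouring
    removeColours (suc j) colouring = removeColours j (removeColour (m≤n+m _ j) colouring)

theorem5p3 : ∀ (n : ℕ) (G : Graph n) → IndependenceNumber≤2 G → χ≤ G (Δ₂ G + 2)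
theorem5p3 n G α≤2 = removeColours G α≤2 n
  -- The n distinct colours are placed among n + (Δ₂ + 2), so that the descent takes n steps however
  -- n compares with Δ₂ + 2.
  ( _↑ˡ (Δ₂ G + 2)
  , λ u v u~v eq → irrefl G (subst (Adj G u) (≡-sym (↑ˡ-injective _ u v eq)) u~v))
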